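{- Let $N$ be a positive integer which is not a perfect square, let $p$ be an integer with $p^2<N$, let $q$ be a positive integer dividing $N-p^2$, and put $\alpha=\frac{\sqrt N+p}{q}$. Then the left-positive path (LPP) of $\alpha$ is purely periodic, i.e. there is a positive integer $T$ such that $x_{n+T}=x_n$ for every non-negative integer $n$, where $(x_n)_{n\ge0}$ is the sequence of numbers in the LPP of $\alpha$.
   Context: The Calkin-Wilf tree of $\alpha$ is the infinite binary tree whose root is labeled $\alpha$ and in which every vertex labeled $x$ has a left child labeled $\frac{x}{x+1}$ and a right child labeled $x+1$ (since $\alpha>0$, all labels are positive). Each vertex carries a triple $(\varepsilon,c,d)$ with $\varepsilon\in\{ -1,1\}$, $c$ an integer, $d$ a positive integer dividing $N-c^2$, and label equal to $\frac{\varepsilon\sqrt N+c}{d}$, defined as follows. The root has triple $(1,p,q)$. If a vertex has triple $(\varepsilon,c,d)$, its right child has triple $(\varepsilon,c+d,d)$; its left child has triple $\left(-\varepsilon,\frac{N-c^2}{d}-c,\frac{N-(c+d)^2}{d}\right)$ if $N-(c+d)^2>0$, and $\left(\varepsilon,c-\frac{N-c^2}{d},\frac{(c+d)^2-N}{d}\right)$ otherwise. The left-positive path (LPP) of $\alpha$ is the infinite descending path which starts at the root and which, from each vertex, goes to the left child if the value of $\varepsilon$ for that left child is $1$, and to the right child otherwise. $x_n$ denotes the label of the $n$-th vertex of the LPP, with $x_0=\alpha$. -}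

module Defs where

open import Data.Integer.Base using (ℤ; +_; 0ℤ; ∣_∣) renaming (_<_ to _<ᶻ_)
import Data.Integer.Base as ℤ
import Data.Integer.Properties as ℤ
open import Data.Integer.Divisibility.Signed using (_∣_; divides; quotient)
open import Data.Integer.Tactic.RingSolver using (solve-∀)
open import Data.Nat.Base as ℕ using (ℕ; zero; suc; NonZero)
open import Data.Product.Base using (∃; _,_)
open import Data.Rational.Base as ℚ using (ℚ; 0ℚ; 1ℚ)
import Data.Rational.Properties as ℚ
open import Data.Sign.Base as Sign using (Sign)
open import Relation.Binary.PropositionalEquality
  using (_≡_; _≢_; refl; trans; cong)
open import Relation.Nullary using (¬_; Dec; yes; no)

PerfectSquare : ℕ → Set
PerfectSquare N = ∃ λ k → N ≡ k ℕ.* k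

-- The real quadratic field ℚ(√N): the element  rat +√ irr  is the real number
-- rat + irr √N.  When N is not a perfect square √N is irrational, so distinct
-- pairs are distinct reals and _≡_ on pairs is equality of real numbers.

infix 5 _+√_

record ℚ[√_] (N : ℕ) : Set where
  constructor _+√_
  field
    rat : ℚ
    irr : ℚ

module _ {N : ℕ} where

  infixl 6 _+_
  infixl 7 _*_ _÷_
  infix  8 _⁻¹

  fromℤ : ℤ → ℚ[√ N ]
  fromℤ i = (i ℚ./ 1) +√ 0ℚ

  1# : ℚ[√ N ]
  1# = fromℤ (+ 1)

  √N : ℚ[√ N ]
  √N = 0ℚ +√ 1ℚ

  _+_ : ℚ[√ N ] → ℚ[√ N ] → ℚ[√ N ]
  (a +√ b) + (a′ +√ b′) = (a ℚ.+ a′) +√ (b ℚ.+ b′)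

  _*_ : ℚ[√ N ] → ℚ[√ N ] → ℚ[√ N ]
  (a +√ b) * (a′ +√ b′) =
    (a ℚ.* a′ ℚ.+ (+ N ℚ./ 1) ℚ.* (b ℚ.* b′)) +√ (a ℚ.* b′ ℚ.+ b ℚ.* a′)

  norm : ℚ[√ N ] → ℚ
  norm (a +√ b) = a ℚ.* a ℚ.- (+ N ℚ./ 1) ℚ.* (b ℚ.* b)

  -- For N not a perfect square the norm vanishes only at zero, so the `yes`
  -- branch is only the convention 0⁻¹ = 0.
  _⁻¹ : ℚ[√ N ] → ℚ[√ N ]
  x@(a +√ b) ⁻¹ with norm x ℚ.≟ 0ℚ
  ... | yes _   = 0ℚ +√ 0ℚ
  ... | no  n≢0 = (a ℚ.* r) +√ (ℚ.- b ℚ.* r)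
    where r = ℚ.1/_ (norm x) {{ℚ.≢-nonZero n≢0}}

  _÷_ : ℚ[√ N ] → ℚ[√ N ] → ℚ[√ N ]
  x ÷ y = x * y ⁻¹

data Vertex : Set where
  root  : Vertex
  left  : Vertex → Vertex
  right : Vertex → Vertex

label : ∀ {N} → ℚ[√ N ] → Vertex → ℚ[√ N ]
label α root      = α
label α (left v)  = label α v ÷ (label α v + 1#)
label α (right v) = label α v + 1#

record Triple (N : ℕ) : Set where
  field
    ε      : Sign
    c      : ℤ
    d      : ℤ
    d>0    : 0ℤ <ᶻ d
    d∣N-c² : d ∣ + N ℤ.- c ℤ.* c

∣-shift : ∀ {n c d} → d ∣ n ℤ.- c ℤ.* c → d ∣ n ℤ.- (c ℤ.+ d) ℤ.* (c ℤ.+ d)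
∣-shift {n} {c} {d} (divides a eq) = divides (a ℤ.- (c ℤ.+ c) ℤ.- d)
  (trans (lem₁ n c d) (trans (cong (ℤ._- ((c ℤ.+ c) ℤ.* d ℤ.+ d ℤ.* d)) eq) (lem₂ a c d)))
  where
  lem₁ : ∀ n c d → n ℤ.- (c ℤ.+ d) ℤ.* (c ℤ.+ d)
                 ≡ n ℤ.- c ℤ.* c ℤ.- ((c ℤ.+ c) ℤ.* d ℤ.+ d ℤ.* d)
  lem₁ = solve-∀
  lem₂ : ∀ a c d → a ℤ.* d ℤ.- ((c ℤ.+ c) ℤ.* d ℤ.+ d ℤ.* d)
                 ≡ (a ℤ.- (c ℤ.+ c) ℤ.- d) ℤ.* d
  lem₂ = solve-∀

module _ {n c d : ℤ} (d∣ : d ∣ n ℤ.- c ℤ.* c) where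

  private
    a = quotient d∣
    b = quotient (∣-shift {n} {c} d∣)

    n≡ : n ≡ a ℤ.* d ℤ.+ c ℤ.* c
    n≡ = trans (lem n c) (cong (ℤ._+ c ℤ.* c) (_∣_.equality d∣))
      where
      lem : ∀ n c → n ≡ n ℤ.- c ℤ.* c ℤ.+ c ℤ.* c
      lem = solve-∀

  ∣-left⁺ : b ∣ n ℤ.- (a ℤ.- c) ℤ.* (a ℤ.- c)
  ∣-left⁺ = divides (ℤ.- a)
    (trans (cong (ℤ._- (a ℤ.- c) ℤ.* (a ℤ.- c)) n≡) (lem a c d))
    where
    lem : ∀ a c d → a ℤ.* d ℤ.+ c ℤ.* c ℤ.- (a ℤ.- c) ℤ.* (a ℤ.- c)
                  ≡ ℤ.- a ℤ.* (a ℤ.- (c ℤ.+ c) ℤ.- d)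
    lem = solve-∀

  ∣-left⁻ : ℤ.- b ∣ n ℤ.- (c ℤ.- a) ℤ.* (c ℤ.- a)
  ∣-left⁻ = divides a
    (trans (cong (ℤ._- (c ℤ.- a) ℤ.* (c ℤ.- a)) n≡) (lem a c d))
    where
    lem : ∀ a c d → a ℤ.* d ℤ.+ c ℤ.* c ℤ.- (c ℤ.- a) ℤ.* (c ℤ.- a)
                  ≡ a ℤ.* ℤ.- (a ℤ.- (c ℤ.+ c) ℤ.- d)
    lem = solve-∀

quotient>0 : ∀ {d m} → 0ℤ <ᶻ d → (d∣m : d ∣ m) → 0ℤ <ᶻ m → 0ℤ <ᶻ quotient d∣m
quotient>0 {d} d>0 (divides q refl) m>0 =
  ℤ.*-cancelʳ-<-nonNeg d {{ℤ.nonNegative (ℤ.<⇒≤ d>0)}} m>0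

quotient<0 : ∀ {d m} → 0ℤ <ᶻ d → (d∣m : d ∣ m) → m <ᶻ 0ℤ → quotient d∣m <ᶻ 0ℤ
quotient<0 {d} d>0 (divides q refl) m<0 =
  ℤ.*-cancelʳ-<-nonNeg d {{ℤ.nonNegative (ℤ.<⇒≤ d>0)}} m<0

N-i²≢0 : ∀ {N} → ¬ PerfectSquare N → ∀ i → + N ℤ.- i ℤ.* i ≢ 0ℤ
N-i²≢0 {N} N≢□ i eq = N≢□ (∣ i ∣ , trans (cong ∣_∣ (ℤ.i-j≡0⇒i≡j (+ N) (i ℤ.* i) eq)) (ℤ.abs-* i i))

rightTriple : ∀ {N} → Triple N → Triple N
rightTriple {N} t = record
  { ε      = ε
  ; c      = c ℤ.+ d
  ; d      = d
  ; d>0    = d>0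
  ; d∣N-c² = ∣-shift {+ N} {c} d∣N-c²
  } where open Triple t

-- Here a = (N - c²)/d and b = (N - (c + d)²)/d; both divisions are exact, and
-- the quotients are unique because d > 0.
leftTriple : ∀ {N} → ¬ PerfectSquare N → Triple N → Triple N
leftTriple {N} N≢□ t = go (0ℤ ℤ.<? + N ℤ.- (c ℤ.+ d) ℤ.* (c ℤ.+ d))
  where
  open Triple t

  d∣N-[c+d]² : d ∣ + N ℤ.- (c ℤ.+ d) ℤ.* (c ℤ.+ d)
  d∣N-[c+d]² = ∣-shift {+ N} {c} d∣N-c²

  a = quotient d∣N-c²
  b = quotient d∣N-[c+d]²

  go : Dec (0ℤ <ᶻ + N ℤ.- (c ℤ.+ d) ℤ.* (c ℤ.+ d)) → Triple N
  go (yes pos) = record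
    { ε      = Sign.opposite ε
    ; c      = a ℤ.- c
    ; d      = b
    ; d>0    = quotient>0 d>0 d∣N-[c+d]² pos
    ; d∣N-c² = ∣-left⁺ {+ N} {c} d∣N-c²
    }
  go (no ¬pos) = record
    { ε      = ε
    ; c      = c ℤ.- a
    ; d      = ℤ.- b
    ; d>0    = ℤ.neg-mono-< (quotient<0 d>0 d∣N-[c+d]²
                 (ℤ.≤∧≢⇒< (ℤ.≮⇒≥ ¬pos) (N-i²≢0 N≢□ (c ℤ.+ d))))
    ; d∣N-c² = ∣-left⁻ {+ N} {c} d∣N-c²
    }

triple : ∀ {N} → ¬ PerfectSquare N → Triple N → Vertex → Triple N
triple N≢□ t₀ root      = t₀
triple N≢□ t₀ (left v)  = leftTriple N≢□ (triple N≢□ t₀ v)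
triple N≢□ t₀ (right v) = rightTriple (triple N≢□ t₀ v)

module _ {N : ℕ} (N≢□ : ¬ PerfectSquare N)
         (p : ℤ) (q : ℕ) .{{_ : NonZero q}} (q∣N-p² : + q ∣ + N ℤ.- p ℤ.* p) where

  α : ℚ[√ N ]
  α = (√N + fromℤ p) ÷ fromℤ (+ q)

  rootTriple : Triple N
  rootTriple = record
    { ε      = Sign.+
    ; c      = p
    ; d      = + q
    ; d>0    = ℤ.+<+ (ℕ.>-nonZero⁻¹ q)
    ; d∣N-c² = q∣N-p²
    }

  LPP : ℕ → Vertex
  LPP zero    = root
  LPP (suc n) with Triple.ε (triple N≢□ rootTriple (left (LPP n)))
  ... | Sign.+ = left (LPP n)
  ... | Sign.- = right (LPP n)

  x : ℕ → ℚ[√ N ]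
  x n = label α (LPP n)

{-# OPTIONS --safe #-}

-- Encode a vertex (1, c, d) of the path by (a, c, d) with a = (N - c²)/d, so that
-- N = a d + c².  With b = a - 2c - d, the path moves right to (b, c + d, d) when
-- b > 0 and left to (a, c - a, -b) when b < 0 (b = 0 would make N = (c + d)² a
-- square), and a, d stay positive.  Hence |a|, |c|, |d| ≤ N and the codes take
-- finitely many values.  The involution c ↦ -c reverses every step, so predecessors
-- are as unique as successors and the sequence of codes, which must repeat, repeats
-- from its first term on.  The code determines the label (√N + c)/d.
module Submission where

open import Defs
open import Algebra.Bundles using (AbelianGroup)
open import Data.Fin.Base using (Fin; fromℕ<; combine; toℕ)
open import Data.Fin.Properties using (pigeonhole; combine-injective; fromℕ<-injective)
open import Data.Integer.Base using (ℤ; +_; 0ℤ; ∣_∣) renaming (_<_ to _<ᶻ_; _-_ to _-ᶻ_; _*_ to _*ᶻ_; _+_ to _+ᶻ_; -_ to -ᶻ_)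
import Data.Integer.Base as ℤ
import Data.Integer.Properties as ℤ
open import Algebra.Properties.Group (AbelianGroup.group ℤ.+-0-abelianGroup) using (∙-cancelʳ)
open import Data.Integer.Divisibility.Signed using (_∣_; quotient)
open import Data.Integer.Tactic.RingSolver using (solve-∀)
open import Data.Nat.Base using (ℕ; zero; suc; _≤_; NonZero; _<_; _∸_) renaming (_+_ to _+ⁿ_; _*_ to _*ⁿ_)
import Data.Nat.Base as ℕ
import Data.Nat.Properties as ℕ
open import Data.Product.Base using (∃; _×_; _,_; proj₁; proj₂)
open import Data.Rational.Base as ℚ using (ℚ; 0ℚ; 1ℚ)
import Data.Rational.Properties as ℚ
open import Data.Rational.Unnormalised.Base using (mkℚᵘ; *≡*)
import Data.Rational.Unnormalised.Base as ℚᵘ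
import Data.Rational.Unnormalised.Properties as ℚᵘ
open import Data.Sign.Base as Sign using (Sign)
open import Data.Sum.Base using (_⊎_; inj₁; inj₂; reduce)
open import Level using (0ℓ)
open import Relation.Binary.PropositionalEquality
  using (_≡_; _≢_; refl; sym; trans; cong; cong₂; subst; module ≡-Reasoning)
open import Relation.Nullary using (¬_; yes; no; contradiction)
open import Relation.Nullary.Decidable using (dec⇒maybe)
open import Tactic.RingSolver using () renaming (solve-∀ to solveIn-∀)
open import Tactic.RingSolver.Core.AlmostCommutativeRing
  using (AlmostCommutativeRing; fromCommutativeRing)

ℚ-ring : AlmostCommutativeRing 0ℓ 0ℓ
ℚ-ring = fromCommutativeRing ℚ.+-*-commutativeRing λ p → dec⇒maybe (0ℚ ℚ.≟ p)

-- Reversible sequences with finitely many values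

-- Pigeonhole on the codes yields one repetition `s i ≡ s j`. Running it backwards with `back` moves
-- it to index 0, which removes any preperiod; `forth` then spreads it to every index.
purelyPeriodic : ∀ {A : Set} {m} (s : ℕ → A) →
  (∀ {i j} → s i ≡ s j → s (suc i) ≡ s (suc j)) →
  (∀ {i j} → s (suc i) ≡ s (suc j) → s i ≡ s j) →
  (code : ℕ → Fin m) → (∀ {i j} → code i ≡ code j → s i ≡ s j) →
  ∃ λ T → 0 < T × (∀ n → s (n +ⁿ T) ≡ s n)
purelyPeriodic {m = m} s forth back code code-inj
  with i , j , i<j , eq ← pigeonhole (ℕ.n<1+n m) (λ k → code (toℕ k))
  = T , ℕ.m<n⇒0<n∸m i<j , forward
  where
  T = toℕ j ∸ toℕ i

  rewind : ∀ k → s (k +ⁿ T) ≡ s k → s T ≡ s 0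
  rewind zero    e = e
  rewind (suc k) e = rewind k (back e)

  forward : ∀ n → s (n +ⁿ T) ≡ s n
  forward zero    = rewind (toℕ i)
    (trans (cong s (ℕ.m+[n∸m]≡n (ℕ.<⇒≤ i<j))) (sym (code-inj eq)))
  forward (suc n) = forth (forward n)

-- Adding `B` moves the interval from `-B` to `B` onto 0, ..., 2B; the absolute value then only
-- converts a non-negative integer to a natural number.
boundedToFin : ∀ {B} i → ∣ i ∣ ≤ B → Fin (suc (B +ⁿ B))
boundedToFin {B} i i≤B =
  fromℕ< {∣ i +ᶻ + B ∣} (ℕ.s≤s (ℕ.≤-trans (ℤ.∣i+j∣≤∣i∣+∣j∣ i (+ B)) (ℕ.+-monoˡ-≤ B i≤B)))

boundedToFin-injective : ∀ {B i j} (i≤B : ∣ i ∣ ≤ B) (j≤B : ∣ j ∣ ≤ B) →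
  boundedToFin i i≤B ≡ boundedToFin j j≤B → i ≡ j
boundedToFin-injective {B} {i} {j} i≤B j≤B eq = ∙-cancelʳ (+ B) i j (begin
  i +ᶻ + B         ≡⟨ ℤ.0≤i⇒+∣i∣≡i (0≤+B {i} i≤B) ⟨
  + ∣ i +ᶻ + B ∣   ≡⟨ cong +_ (fromℕ<-injective _ _ _ _ eq) ⟩
  + ∣ j +ᶻ + B ∣   ≡⟨ ℤ.0≤i⇒+∣i∣≡i (0≤+B {j} j≤B) ⟩
  j +ᶻ + B         ∎)
  where
  open ≡-Reasoning
  0≤+B : ∀ {i} → ∣ i ∣ ≤ B → 0ℤ ℤ.≤ i +ᶻ + B
  0≤+B {+ n}        _   = ℤ.+≤+ ℕ.z≤n
  0≤+B {ℤ.-[1+ n ]} n<B = subst (0ℤ ℤ.≤_) (sym (ℤ.⊖-≥ n<B)) (ℤ.+≤+ ℕ.z≤n)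

-- Quadratic forms and the step relation

-- If `N = a d + c²`, then (√N + c)/d is a root of `d X² - 2 c X - a`, a quadratic polynomial of
-- discriminant 4N.
record Form : Set where
  constructor ⟨_,_,_⟩
  field
    coeffA coeffC coeffD : ℤ

open Form

-- On roots this is minus the conjugate: (√N + c)/d becomes (√N - c)/d.
flip : Form → Form
flip ⟨ a , c , d ⟩ = ⟨ a , -ᶻ c , d ⟩

flip-injective : ∀ {s t} → flip s ≡ flip t → s ≡ t
flip-injective {⟨ a , c , d ⟩} {⟨ a′ , c′ , d′ ⟩} eq
  rewrite cong coeffA eq | ℤ.neg-injective (cong coeffC eq) | cong coeffD eq = refl

infix 4 _↝_

-- The quantity `b = a - 2c - d` whose sign is tested equals (N - (c + d)²)/d when `N = a d + c²`,
-- so the moves can be stated without `N` or ε.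
data _↝_ : Form → Form → Set where
  left↝  : ∀ {a c d} → 0ℤ <ᶻ -ᶻ (a -ᶻ (c +ᶻ c) -ᶻ d) →
           ⟨ a , c , d ⟩ ↝ ⟨ a , c -ᶻ a , -ᶻ (a -ᶻ (c +ᶻ c) -ᶻ d) ⟩
  right↝ : ∀ {a c d} → 0ℤ <ᶻ a -ᶻ (c +ᶻ c) -ᶻ d →
           ⟨ a , c , d ⟩ ↝ ⟨ a -ᶻ (c +ᶻ c) -ᶻ d , c +ᶻ d , d ⟩

0≮i∧0≮-i : ∀ {i} → 0ℤ <ᶻ i → ¬ (0ℤ <ᶻ -ᶻ i)
0≮i∧0≮-i {i} 0<i 0<-i = ℤ.<-asym (ℤ.neg-mono-< 0<i) 0<-i

↝-deterministic : ∀ {s t t′} → s ↝ t → s ↝ t′ → t ≡ t′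
↝-deterministic (left↝ _)  (left↝ _)  = refl
↝-deterministic (left↝ n)  (right↝ p) = contradiction n (0≮i∧0≮-i p)
↝-deterministic (right↝ p) (left↝ n)  = contradiction n (0≮i∧0≮-i p)
↝-deterministic (right↝ _) (right↝ _) = refl

Positive : Form → Set
Positive ⟨ a , c , d ⟩ = 0ℤ <ᶻ a × 0ℤ <ᶻ d

-- On the flipped target the tested quantity is `-d` after a left move and `a` after a right move.
-- Positivity of the source therefore allows a move of the same kind, which undoes the original one.
↝-reverse : ∀ {s t} → Positive s → s ↝ t → flip t ↝ flip s
↝-reverse {⟨ a , c , d ⟩} (_ , d>0) (left↝ _) =
  subst (flip ⟨ a , c -ᶻ a , e ⟩ ↝_) (cong₂ ⟨ a ,_,_⟩ (lem₁ a c) (lem₂ a c d))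
    (left↝ (subst (0ℤ <ᶻ_) (sym (lem₂ a c d)) d>0))
  where
  e = -ᶻ (a -ᶻ (c +ᶻ c) -ᶻ d)
  lem₁ : ∀ a c → -ᶻ (c -ᶻ a) -ᶻ a ≡ -ᶻ c
  lem₁ = solve-∀
  lem₂ : ∀ a c d → -ᶻ (a -ᶻ (-ᶻ (c -ᶻ a) +ᶻ -ᶻ (c -ᶻ a)) -ᶻ (-ᶻ (a -ᶻ (c +ᶻ c) -ᶻ d))) ≡ d
  lem₂ = solve-∀
↝-reverse {⟨ a , c , d ⟩} (a>0 , _) (right↝ _) =
  subst (flip ⟨ b , c +ᶻ d , d ⟩ ↝_) (cong₂ ⟨_,_, d ⟩ (lem₂ a c d) (lem₁ c d))
    (right↝ (subst (0ℤ <ᶻ_) (sym (lem₂ a c d)) a>0))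
  where
  b = a -ᶻ (c +ᶻ c) -ᶻ d
  lem₁ : ∀ c d → -ᶻ (c +ᶻ d) +ᶻ d ≡ -ᶻ c
  lem₁ = solve-∀
  lem₂ : ∀ a c d → a -ᶻ (c +ᶻ c) -ᶻ d -ᶻ (-ᶻ (c +ᶻ d) +ᶻ -ᶻ (c +ᶻ d)) -ᶻ d ≡ a
  lem₂ = solve-∀

-- Two predecessors of `t` flip to two successors of `flip t`.
↝-injective : ∀ {s s′ t} → Positive s → Positive s′ → s ↝ t → s′ ↝ t → s ≡ s′
↝-injective s>0 s′>0 s↝t s′↝t =
  flip-injective (↝-deterministic (↝-reverse s>0 s↝t) (↝-reverse s′>0 s′↝t))

-- Size bounds and finite coding of forms

m≤m*m : ∀ m → m ≤ m *ⁿ m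
m≤m*m zero    = ℕ.z≤n
m≤m*m (suc m) = ℕ.m≤m*n (suc m) (suc m)

BoundedBy : ℕ → Form → Set
BoundedBy B ⟨ a , c , d ⟩ = ∣ a ∣ ≤ B × ∣ c ∣ ≤ B × ∣ d ∣ ≤ B

encode : ∀ {B} s → BoundedBy B s → Fin (suc (B +ⁿ B) *ⁿ (suc (B +ⁿ B) *ⁿ suc (B +ⁿ B)))
encode ⟨ a , c , d ⟩ (a≤B , c≤B , d≤B) =
  combine (boundedToFin a a≤B) (combine (boundedToFin c c≤B) (boundedToFin d d≤B))

encode-injective : ∀ {B s t} (s≤B : BoundedBy B s) (t≤B : BoundedBy B t) →
  encode s s≤B ≡ encode t t≤B → s ≡ t
encode-injective {s = ⟨ a , c , d ⟩} {⟨ a′ , c′ , d′ ⟩} (a≤B , c≤B , d≤B) (a′≤B , c′≤B , d′≤B) eq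
  with eqA , eqCD ← combine-injective (boundedToFin a a≤B) _ (boundedToFin a′ a′≤B) _ eq
  with eqC , eqD ← combine-injective (boundedToFin c c≤B) _ (boundedToFin c′ c′≤B) _ eqCD
  with refl ← boundedToFin-injective {i = a} {a′} a≤B a′≤B eqA
     | refl ← boundedToFin-injective {i = c} {c′} c≤B c′≤B eqC
     | refl ← boundedToFin-injective {i = d} {d′} d≤B d′≤B eqD = refl

-- In `a d + c² = N` both summands are non-negative, so each is at most `N`; and `a`, `d` are at
-- most `a d` because both are at least 1.
Positive⇒bounded : ∀ {N s} → Positive s → + N -ᶻ coeffC s *ᶻ coeffC s ≡ coeffA s *ᶻ coeffD s →
  BoundedBy N s
Positive⇒bounded {N} {⟨ + suc a , c , + suc d ⟩} (ℤ.+<+ _ , ℤ.+<+ _) eq =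
  ℕ.≤-trans (ℕ.m≤m*n (suc a) (suc d)) ad≤N ,
  ℕ.≤-trans (m≤m*m ∣ c ∣) (subst (∣ c ∣ *ⁿ ∣ c ∣ ≤_) total (ℕ.m≤n+m _ _)) ,
  ℕ.≤-trans (ℕ.m≤n*m (suc d) (suc a)) ad≤N
  where
  c² : ∀ c → + (∣ c ∣ *ⁿ ∣ c ∣) ≡ c *ᶻ c
  c² (+ n)        = ℤ.pos-* n n
  c² ℤ.-[1+ n ]   = refl
  lem : ∀ n s → n -ᶻ s +ᶻ s ≡ n
  lem = solve-∀
  total : suc a *ⁿ suc d +ⁿ ∣ c ∣ *ⁿ ∣ c ∣ ≡ N
  total = ℤ.+-injective (begin
    + (suc a *ⁿ suc d) +ᶻ + (∣ c ∣ *ⁿ ∣ c ∣)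
      ≡⟨ cong₂ _+ᶻ_ (trans (ℤ.pos-* (suc a) (suc d)) (sym eq)) (c² c) ⟩
    + N -ᶻ c *ᶻ c +ᶻ c *ᶻ c                   ≡⟨ lem (+ N) (c *ᶻ c) ⟩
    + N                                       ∎)
    where open ≡-Reasoning
  ad≤N : suc a *ⁿ suc d ≤ N
  ad≤N = subst (suc a *ⁿ suc d ≤_) total (ℕ.m≤m+n _ _)

-- The embedding of ℤ in ℚ

ι : ℤ → ℚ
ι i = i ℚ./ 1

ι-injective : ∀ {i j} → ι i ≡ ι j → i ≡ j
ι-injective {i} {j} eq with *≡* e ← ℚ.fromℚᵘ-injective {mkℚᵘ i 0} {mkℚᵘ j 0} eq =
  trans (sym (ℤ.*-identityʳ i)) (trans e (ℤ.*-identityʳ j))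

-- Normalisation by gcd blocks computation in ℚ for a variable numerator; among unnormalised
-- fractions the claim is an integer identity.
ι-+ : ∀ i j → ι (i +ᶻ j) ≡ ι i ℚ.+ ι j
ι-+ i j = ℚ.toℚᵘ-injective (begin
  ℚ.toℚᵘ (ι (i +ᶻ j))                 ≈⟨ ℚ.toℚᵘ-fromℚᵘ (mkℚᵘ (i +ᶻ j) 0) ⟩
  mkℚᵘ (i +ᶻ j) 0                     ≈⟨ *≡* (lem i j) ⟩
  mkℚᵘ i 0 ℚᵘ.+ mkℚᵘ j 0              ≈⟨ ℚᵘ.+-cong (ℚ.toℚᵘ-fromℚᵘ (mkℚᵘ i 0)) (ℚ.toℚᵘ-fromℚᵘ (mkℚᵘ j 0)) ⟨
  ℚ.toℚᵘ (ι i) ℚᵘ.+ ℚ.toℚᵘ (ι j)      ≈⟨ ℚ.toℚᵘ-homo-+ (ι i) (ι j) ⟨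
  ℚ.toℚᵘ (ι i ℚ.+ ι j)                ∎)
  where
  open ℚᵘ.≃-Reasoning
  lem : ∀ i j → (i +ᶻ j) *ᶻ + 1 ≡ (i *ᶻ + 1 +ᶻ j *ᶻ + 1) *ᶻ + 1
  lem = solve-∀

ι-* : ∀ i j → ι (i *ᶻ j) ≡ ι i ℚ.* ι j
ι-* i j = ℚ.toℚᵘ-injective (begin
  ℚ.toℚᵘ (ι (i *ᶻ j))                 ≈⟨ ℚ.toℚᵘ-fromℚᵘ (mkℚᵘ (i *ᶻ j) 0) ⟩
  mkℚᵘ (i *ᶻ j) 0                     ≈⟨ *≡* refl ⟩
  mkℚᵘ i 0 ℚᵘ.* mkℚᵘ j 0              ≈⟨ ℚᵘ.*-cong (ℚ.toℚᵘ-fromℚᵘ (mkℚᵘ i 0)) (ℚ.toℚᵘ-fromℚᵘ (mkℚᵘ j 0)) ⟨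
  ℚ.toℚᵘ (ι i) ℚᵘ.* ℚ.toℚᵘ (ι j)      ≈⟨ ℚ.toℚᵘ-homo-* (ι i) (ι j) ⟨
  ℚ.toℚᵘ (ι i ℚ.* ι j)                ∎)
  where open ℚᵘ.≃-Reasoning

ι-neg : ∀ i → ι (-ᶻ i) ≡ ℚ.- ι i
ι-neg (+ zero)     = refl
ι-neg (+ suc n)    = refl
ι-neg ℤ.-[1+ n ]   = lem _
  where
  lem : ∀ p → p ≡ ℚ.- (ℚ.- p)
  lem = solveIn-∀ ℚ-ring

ι-- : ∀ i j → ι (i -ᶻ j) ≡ ι i ℚ.- ι j
ι-- i j = trans (ι-+ i (-ᶻ j)) (cong (ι i ℚ.+_) (ι-neg j))

-- Labels in ℚ(√N)

-- Replaces the case split inside `_⁻¹` by an opaque `r` with `norm z * r = 1`, so that later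
-- computations are polynomial identities in `r`.
⁻¹-spec : ∀ {N} (z : ℚ[√ N ]) → norm z ≢ 0ℚ →
  ∃ λ r → norm z ℚ.* r ≡ 1ℚ × z ⁻¹ ≡ (ℚ[√_].rat z ℚ.* r +√ (ℚ.- ℚ[√_].irr z ℚ.* r))
⁻¹-spec z@(a +√ b) n≢0 with norm z ℚ.≟ 0ℚ
... | yes n≡0 = contradiction n≡0 n≢0
... | no  n≢0 = _ , ℚ.*-inverseʳ (norm z) {{ℚ.≢-nonZero n≢0}} , refl

-- y = (√N + c)/d, with the denominators cleared.
record _IsLabelOf_ {N} (y : ℚ[√ N ]) (s : Form) : Set where
  constructor isLabel
  field
    rat*d : ℚ[√_].rat y ℚ.* ι (coeffD s) ≡ ι (coeffC s)
    irr*d : ℚ[√_].irr y ℚ.* ι (coeffD s) ≡ 1ℚ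

-- The equation `v d = 1` makes `v` an inverse of `d`, which cancels the common factor.
IsLabelOf-unique : ∀ {N s} {y y′ : ℚ[√ N ]} → y IsLabelOf s → y′ IsLabelOf s → y ≡ y′
IsLabelOf-unique {s = s} {u +√ v} {u′ +√ v′} (isLabel ud vd) (isLabel u′d v′d) = cong₂ _+√_
  (cancel (trans ud (sym u′d))) (cancel (trans vd (sym v′d)))
  where
  D = ι (coeffD s)
  swap : ∀ w v D → w ℚ.* (v ℚ.* D) ≡ v ℚ.* (w ℚ.* D)
  swap = solveIn-∀ ℚ-ring
  cancel : ∀ {w w′} → w ℚ.* D ≡ w′ ℚ.* D → w ≡ w′
  cancel {w} {w′} eq = begin
    w                   ≡⟨ ℚ.*-identityʳ w ⟨
    w ℚ.* 1ℚ            ≡⟨ cong (w ℚ.*_) vd ⟨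
    w ℚ.* (v ℚ.* D)     ≡⟨ swap w v D ⟩
    v ℚ.* (w ℚ.* D)     ≡⟨ cong (v ℚ.*_) eq ⟩
    v ℚ.* (w′ ℚ.* D)    ≡⟨ swap w′ v D ⟨
    w′ ℚ.* (v ℚ.* D)    ≡⟨ cong (w′ ℚ.*_) vd ⟩
    w′ ℚ.* 1ℚ           ≡⟨ ℚ.*-identityʳ w′ ⟩
    w′                  ∎
    where open ≡-Reasoning

IsLabelOf-right : ∀ {N a a′ c d} {y : ℚ[√ N ]} →
  y IsLabelOf ⟨ a , c , d ⟩ → (y + 1#) IsLabelOf ⟨ a′ , c +ᶻ d , d ⟩
IsLabelOf-right {c = c} {d} {u +√ v} (isLabel ud vd) = isLabel
  (trans (lem₁ u (ι d)) (trans (cong (ℚ._+ ι d) ud) (sym (ι-+ c d))))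
  (trans (lem₂ v (ι d)) vd)
  where
  lem₁ : ∀ u D → (u ℚ.+ 1ℚ) ℚ.* D ≡ u ℚ.* D ℚ.+ D
  lem₁ = solveIn-∀ ℚ-ring
  lem₂ : ∀ v D → (v ℚ.+ 0ℚ) ℚ.* D ≡ v ℚ.* D
  lem₂ = solveIn-∀ ℚ-ring

-- Write y/(y + 1) as y(y′ + 1)/norm(y + 1), with y′ the conjugate. Since y y′ = -a/d, the numerator
-- is (√N + c - a)/d, and the denominator is -b/d.
IsLabelOf-left : ∀ {N a c d} {y : ℚ[√ N ]} → + N -ᶻ c *ᶻ c ≡ a *ᶻ d →
  let b = a -ᶻ (c +ᶻ c) -ᶻ d in 0ℤ <ᶻ -ᶻ b →
  y IsLabelOf ⟨ a , c , d ⟩ → (y ÷ (y + 1#)) IsLabelOf ⟨ a , c -ᶻ a , -ᶻ b ⟩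
IsLabelOf-left {N} {a} {c} {d} {y@(u +√ v)} N-c²≡ad -b>0 (isLabel ud vd) = goal (⁻¹-spec (y + 1#) n≢0)
  where
  open ≡-Reasoning
  b = a -ᶻ (c +ᶻ c) -ᶻ d
  A = ι a
  C = ι c
  D = ι d
  M = ι (+ N)
  n = norm (y + 1#)

  -- This is `a = -d (u² - N v²)`, that is -d times the norm of `y`, simplified by `u d = c` and
  -- `v d = 1`.
  a≡ : A ≡ M ℚ.* v ℚ.- u ℚ.* C
  a≡ = begin
    A                                            ≡⟨ ℚ.*-identityʳ A ⟨
    A ℚ.* 1ℚ                                     ≡⟨ cong (A ℚ.*_) vd ⟨
    A ℚ.* (v ℚ.* D)                              ≡⟨ lem₁ A v D ⟩
    v ℚ.* (A ℚ.* D)                              ≡⟨ cong (v ℚ.*_) AD≡ ⟩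
    v ℚ.* (M ℚ.- C ℚ.* C)                        ≡⟨ cong (λ □ → v ℚ.* (M ℚ.- □ ℚ.* C)) ud ⟨
    v ℚ.* (M ℚ.- u ℚ.* D ℚ.* C)                  ≡⟨ lem₂ v M u D C ⟩
    M ℚ.* v ℚ.- u ℚ.* C ℚ.* (v ℚ.* D)            ≡⟨ cong (λ □ → M ℚ.* v ℚ.- u ℚ.* C ℚ.* □) vd ⟩
    M ℚ.* v ℚ.- u ℚ.* C ℚ.* 1ℚ                   ≡⟨ lem₃ M v u C ⟩
    M ℚ.* v ℚ.- u ℚ.* C                          ∎
    where
    AD≡ : A ℚ.* D ≡ M ℚ.- C ℚ.* C
    AD≡ = begin
      A ℚ.* D              ≡⟨ ι-* a d ⟨
      ι (a *ᶻ d)           ≡⟨ cong ι N-c²≡ad ⟨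
      ι (+ N -ᶻ c *ᶻ c)    ≡⟨ ι-- (+ N) (c *ᶻ c) ⟩
      M ℚ.- ι (c *ᶻ c)     ≡⟨ cong (λ □ → M ℚ.- □) (ι-* c c) ⟩
      M ℚ.- C ℚ.* C        ∎
    lem₁ : ∀ A v D → A ℚ.* (v ℚ.* D) ≡ v ℚ.* (A ℚ.* D)
    lem₁ = solveIn-∀ ℚ-ring
    lem₂ : ∀ v M u D C → v ℚ.* (M ℚ.- u ℚ.* D ℚ.* C) ≡ M ℚ.* v ℚ.- u ℚ.* C ℚ.* (v ℚ.* D)
    lem₂ = solveIn-∀ ℚ-ring
    lem₃ : ∀ M v u C → M ℚ.* v ℚ.- u ℚ.* C ℚ.* 1ℚ ≡ M ℚ.* v ℚ.- u ℚ.* C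
    lem₃ = solveIn-∀ ℚ-ring

  -b≡ : ι (-ᶻ b) ≡ C ℚ.+ C ℚ.+ D ℚ.- A
  -b≡ = begin
    ι (-ᶻ b)                   ≡⟨ cong ι (lem a c d) ⟩
    ι (c +ᶻ c +ᶻ d -ᶻ a)       ≡⟨ ι-- (c +ᶻ c +ᶻ d) a ⟩
    ι (c +ᶻ c +ᶻ d) ℚ.- A      ≡⟨ cong (ℚ._- A) (ι-+ (c +ᶻ c) d) ⟩
    ι (c +ᶻ c) ℚ.+ D ℚ.- A     ≡⟨ cong (λ □ → □ ℚ.+ D ℚ.- A) (ι-+ c c) ⟩
    C ℚ.+ C ℚ.+ D ℚ.- A        ∎
    where
    lem : ∀ a c d → -ᶻ (a -ᶻ (c +ᶻ c) -ᶻ d) ≡ c +ᶻ c +ᶻ d -ᶻ a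
    lem = solve-∀

  -- The norm of `y + 1` times `d` is the value of `d X² - 2 c X - a` at -1.
  nd≡-b : n ℚ.* D ≡ ι (-ᶻ b)
  nd≡-b = begin
    n ℚ.* D
      ≡⟨ lem₁ u v M D ⟩
    u ℚ.* (u ℚ.* D) ℚ.+ (u ℚ.* D ℚ.+ u ℚ.* D ℚ.+ D) ℚ.- M ℚ.* v ℚ.* (v ℚ.* D)
      ≡⟨ cong₂ (λ □ ○ → u ℚ.* □ ℚ.+ (□ ℚ.+ □ ℚ.+ D) ℚ.- M ℚ.* v ℚ.* ○) ud vd ⟩
    u ℚ.* C ℚ.+ (C ℚ.+ C ℚ.+ D) ℚ.- M ℚ.* v ℚ.* 1ℚ
      ≡⟨ lem₂ u C D M v ⟩
    C ℚ.+ C ℚ.+ D ℚ.- (M ℚ.* v ℚ.- u ℚ.* C)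
      ≡⟨ cong (λ □ → C ℚ.+ C ℚ.+ D ℚ.- □) a≡ ⟨
    C ℚ.+ C ℚ.+ D ℚ.- A
      ≡⟨ -b≡ ⟨
    ι (-ᶻ b)
      ∎
    where
    lem₁ : ∀ u v M D →
      ((u ℚ.+ 1ℚ) ℚ.* (u ℚ.+ 1ℚ) ℚ.- M ℚ.* ((v ℚ.+ 0ℚ) ℚ.* (v ℚ.+ 0ℚ))) ℚ.* D ≡
      u ℚ.* (u ℚ.* D) ℚ.+ (u ℚ.* D ℚ.+ u ℚ.* D ℚ.+ D) ℚ.- M ℚ.* v ℚ.* (v ℚ.* D)
    lem₁ = solveIn-∀ ℚ-ring
    lem₂ : ∀ u C D M v → u ℚ.* C ℚ.+ (C ℚ.+ C ℚ.+ D) ℚ.- M ℚ.* v ℚ.* 1ℚ ≡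
      C ℚ.+ C ℚ.+ D ℚ.- (M ℚ.* v ℚ.- u ℚ.* C)
    lem₂ = solveIn-∀ ℚ-ring

  n≢0 : n ≢ 0ℚ
  n≢0 n≡0 = ℤ.<⇒≢ -b>0 (sym (ι-injective (begin
    ι (-ᶻ b)    ≡⟨ nd≡-b ⟨
    n ℚ.* D     ≡⟨ cong (ℚ._* D) n≡0 ⟩
    0ℚ ℚ.* D    ≡⟨ ℚ.*-zeroˡ D ⟩
    0ℚ          ∎)))

  goal : (∃ λ r → n ℚ.* r ≡ 1ℚ × (y + 1#) ⁻¹ ≡ ((u ℚ.+ 1ℚ) ℚ.* r +√ (ℚ.- (v ℚ.+ 0ℚ) ℚ.* r))) →
         (y ÷ (y + 1#)) IsLabelOf ⟨ a , c -ᶻ a , -ᶻ b ⟩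
  goal (r , nr≡1 , inv) = subst (_IsLabelOf ⟨ a , c -ᶻ a , -ᶻ b ⟩) (cong (y *_) (sym inv)) (isLabel rat irr)
    where
    -- The first factor is the rational part of the product as `_*_` unfolds, with `0ℚ` coming from
    -- `1#`. Replacing `-b` by `n d` pairs `n` with `r`.
    rat : (u ℚ.* ((u ℚ.+ 1ℚ) ℚ.* r) ℚ.+ M ℚ.* (v ℚ.* (ℚ.- (v ℚ.+ 0ℚ) ℚ.* r))) ℚ.* ι (-ᶻ b) ≡ ι (c -ᶻ a)
    rat = begin
      (u ℚ.* ((u ℚ.+ 1ℚ) ℚ.* r) ℚ.+ M ℚ.* (v ℚ.* (ℚ.- (v ℚ.+ 0ℚ) ℚ.* r))) ℚ.* ι (-ᶻ b)
        ≡⟨ cong ((u ℚ.* ((u ℚ.+ 1ℚ) ℚ.* r) ℚ.+ M ℚ.* (v ℚ.* (ℚ.- (v ℚ.+ 0ℚ) ℚ.* r))) ℚ.*_) nd≡-b ⟨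
      (u ℚ.* ((u ℚ.+ 1ℚ) ℚ.* r) ℚ.+ M ℚ.* (v ℚ.* (ℚ.- (v ℚ.+ 0ℚ) ℚ.* r))) ℚ.* (n ℚ.* D)
        ≡⟨ lem₁ u v r M n D ⟩
      (u ℚ.* (u ℚ.* D) ℚ.+ u ℚ.* D ℚ.- M ℚ.* v ℚ.* (v ℚ.* D)) ℚ.* (n ℚ.* r)
        ≡⟨ cong₂ (λ □ ○ → (u ℚ.* □ ℚ.+ □ ℚ.- M ℚ.* v ℚ.* (v ℚ.* D)) ℚ.* ○) ud nr≡1 ⟩
      (u ℚ.* C ℚ.+ C ℚ.- M ℚ.* v ℚ.* (v ℚ.* D)) ℚ.* 1ℚ
        ≡⟨ cong (λ □ → (u ℚ.* C ℚ.+ C ℚ.- M ℚ.* v ℚ.* □) ℚ.* 1ℚ) vd ⟩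
      (u ℚ.* C ℚ.+ C ℚ.- M ℚ.* v ℚ.* 1ℚ) ℚ.* 1ℚ
        ≡⟨ lem₂ u C M v ⟩
      C ℚ.- (M ℚ.* v ℚ.- u ℚ.* C)
        ≡⟨ cong (λ □ → C ℚ.- □) a≡ ⟨
      C ℚ.- A
        ≡⟨ ι-- c a ⟨
      ι (c -ᶻ a)
        ∎
      where
      lem₁ : ∀ u v r M n D →
        (u ℚ.* ((u ℚ.+ 1ℚ) ℚ.* r) ℚ.+ M ℚ.* (v ℚ.* (ℚ.- (v ℚ.+ 0ℚ) ℚ.* r))) ℚ.* (n ℚ.* D) ≡
        (u ℚ.* (u ℚ.* D) ℚ.+ u ℚ.* D ℚ.- M ℚ.* v ℚ.* (v ℚ.* D)) ℚ.* (n ℚ.* r)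
      lem₁ = solveIn-∀ ℚ-ring
      lem₂ : ∀ u C M v → (u ℚ.* C ℚ.+ C ℚ.- M ℚ.* v ℚ.* 1ℚ) ℚ.* 1ℚ ≡ C ℚ.- (M ℚ.* v ℚ.- u ℚ.* C)
      lem₂ = solveIn-∀ ℚ-ring

    irr : (u ℚ.* (ℚ.- (v ℚ.+ 0ℚ) ℚ.* r) ℚ.+ v ℚ.* ((u ℚ.+ 1ℚ) ℚ.* r)) ℚ.* ι (-ᶻ b) ≡ 1ℚ
    irr = begin
      (u ℚ.* (ℚ.- (v ℚ.+ 0ℚ) ℚ.* r) ℚ.+ v ℚ.* ((u ℚ.+ 1ℚ) ℚ.* r)) ℚ.* ι (-ᶻ b)
        ≡⟨ cong ((u ℚ.* (ℚ.- (v ℚ.+ 0ℚ) ℚ.* r) ℚ.+ v ℚ.* ((u ℚ.+ 1ℚ) ℚ.* r)) ℚ.*_) nd≡-b ⟨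
      (u ℚ.* (ℚ.- (v ℚ.+ 0ℚ) ℚ.* r) ℚ.+ v ℚ.* ((u ℚ.+ 1ℚ) ℚ.* r)) ℚ.* (n ℚ.* D)
        ≡⟨ lem u v r n D ⟩
      (v ℚ.* D) ℚ.* (n ℚ.* r)
        ≡⟨ cong₂ ℚ._*_ vd nr≡1 ⟩
      1ℚ
        ∎
      where
      lem : ∀ u v r n D →
        (u ℚ.* (ℚ.- (v ℚ.+ 0ℚ) ℚ.* r) ℚ.+ v ℚ.* ((u ℚ.+ 1ℚ) ℚ.* r)) ℚ.* (n ℚ.* D) ≡
        (v ℚ.* D) ℚ.* (n ℚ.* r)
      lem = solveIn-∀ ℚ-ring

-- Triples and labels along the left-positive path

module _ {N : ℕ} (N≢□ : ¬ PerfectSquare N) where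

  form : Triple N → Form
  form t = ⟨ quotient d∣N-c² , c , d ⟩ where open Triple t

  -- From ε = 1, the left child keeps its sign exactly when `b < 0`; `b = 0` would make `N` the
  -- square of `c + d`. The form equation is `refl` because the divisibility witnesses have `a` and
  -- `b` as their quotients by definition.
  leftTriple-step : ∀ t → Triple.ε t ≡ Sign.+ →
    let ⟨ a , c , d ⟩ = form t
        b = a -ᶻ (c +ᶻ c) -ᶻ d
        l = leftTriple N≢□ t in
    (0ℤ <ᶻ -ᶻ b × Triple.ε l ≡ Sign.+ × form l ≡ ⟨ a , c -ᶻ a , -ᶻ b ⟩) ⊎
    (0ℤ <ᶻ b × Triple.ε l ≡ Sign.-)
  leftTriple-step t ε≡+
    with 0ℤ ℤ.<? + N -ᶻ (Triple.c t +ᶻ Triple.d t) *ᶻ (Triple.c t +ᶻ Triple.d t)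
  ... | yes pos = inj₂ (quotient>0 d>0 (∣-shift {+ N} {c} d∣N-c²) pos ,
                        cong Sign.opposite ε≡+)
    where open Triple t
  ... | no ¬pos = inj₁ (ℤ.neg-mono-< (quotient<0 d>0 (∣-shift {+ N} {c} d∣N-c²)
                          (ℤ.≤∧≢⇒< (ℤ.≮⇒≥ ¬pos) (N-i²≢0 N≢□ (c +ᶻ d)))) ,
                        ε≡+ , refl)
    where open Triple t

  module _ (p : ℤ) (q : ℕ) .{{_ : NonZero q}} (q∣N-p² : + q ∣ + N -ᶻ p *ᶻ p) where

    tripleAt : Vertex → Triple N
    tripleAt = triple N≢□ (rootTriple N≢□ p q q∣N-p²)

    labelAt : Vertex → ℚ[√ N ]
    labelAt = label (α N≢□ p q q∣N-p²)

    path : ℕ → Vertex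
    path = LPP N≢□ p q q∣N-p²

    formAt : ℕ → Form
    formAt n = form (tripleAt (path n))

    -- The norm of the integer `q` is `q²`, so its inverse is `q r` with `q² r = 1`, and multiplying
    -- `α` by `q` gives √N + p.
    α-isLabel : ∀ {a} → α N≢□ p q q∣N-p² IsLabelOf ⟨ a , p , + q ⟩
    α-isLabel {a} = goal (⁻¹-spec (fromℤ (+ q)) n≢0)
      where
      open ≡-Reasoning
      P = ι p
      Q = ι (+ q)
      M = ι (+ N)
      n = norm {N} (fromℤ (+ q))

      n≢0 : n ≢ 0ℚ
      n≢0 n≡0 = ℕ.≢-nonZero⁻¹ q (ℤ.+-injective
        (reduce (ℤ.i*j≡0⇒i≡0∨j≡0 (+ q) (ι-injective (begin
          ι (+ q *ᶻ + q)    ≡⟨ ι-* (+ q) (+ q) ⟩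
          Q ℚ.* Q           ≡⟨ lem Q M ⟨
          n                 ≡⟨ n≡0 ⟩
          0ℚ                ∎)))))
        where
        lem : ∀ Q M → Q ℚ.* Q ℚ.- M ℚ.* (0ℚ ℚ.* 0ℚ) ≡ Q ℚ.* Q
        lem = solveIn-∀ ℚ-ring

      goal : (∃ λ r → n ℚ.* r ≡ 1ℚ × fromℤ {N} (+ q) ⁻¹ ≡ (Q ℚ.* r +√ (ℚ.- 0ℚ ℚ.* r))) →
             α N≢□ p q q∣N-p² IsLabelOf ⟨ a , p , + q ⟩
      goal (r , nr≡1 , inv) = subst (_IsLabelOf ⟨ a , p , + q ⟩)
        (cong ((√N + fromℤ p) *_) (sym inv)) (isLabel
          (trans (lem₁ P Q r M) (trans (cong (P ℚ.*_) nr≡1) (ℚ.*-identityʳ P)))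
          (trans (lem₂ P Q r M) nr≡1))
        where
        lem₁ : ∀ P Q r M →
          ((0ℚ ℚ.+ P) ℚ.* (Q ℚ.* r) ℚ.+ M ℚ.* ((1ℚ ℚ.+ 0ℚ) ℚ.* (ℚ.- 0ℚ ℚ.* r))) ℚ.* Q ≡
          P ℚ.* ((Q ℚ.* Q ℚ.- M ℚ.* (0ℚ ℚ.* 0ℚ)) ℚ.* r)
        lem₁ = solveIn-∀ ℚ-ring
        lem₂ : ∀ P Q r M →
          ((0ℚ ℚ.+ P) ℚ.* (ℚ.- 0ℚ ℚ.* r) ℚ.+ (1ℚ ℚ.+ 0ℚ) ℚ.* (Q ℚ.* r)) ℚ.* Q ≡
          (Q ℚ.* Q ℚ.- M ℚ.* (0ℚ ℚ.* 0ℚ)) ℚ.* r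
        lem₂ = solveIn-∀ ℚ-ring

    -- The invariant of the path. The sign stays 1, since a left move is made only onto sign 1 and a
    -- right move copies the sign.
    record OnPath (v : Vertex) : Set where
      field
        ε≡+       : Triple.ε (tripleAt v) ≡ Sign.+
        a>0       : 0ℤ <ᶻ coeffA (form (tripleAt v))
        isLabelOf : labelAt v IsLabelOf form (tripleAt v)

    open OnPath

    path-left : ∀ n → Triple.ε (tripleAt (left (path n))) ≡ Sign.+ → path (suc n) ≡ left (path n)
    path-left n eq rewrite eq = refl

    path-right : ∀ n → Triple.ε (tripleAt (left (path n))) ≡ Sign.- → path (suc n) ≡ right (path n)
    path-right n eq rewrite eq = refl

    -- The path tests ε of the left child and `_↝_` tests the sign of `b`; `leftTriple-step`
    -- identifies the two. A left move keeps `a`, and a right move makes the positive `b` the new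
    -- `a`.
    path-step : ∀ n → OnPath (path n) → formAt n ↝ formAt (suc n) × OnPath (path (suc n))
    path-step n on with leftTriple-step (tripleAt (path n)) (ε≡+ on)
    ... | inj₁ (-b>0 , ε≡+′ , form≡) rewrite path-left n ε≡+′ =
      subst (formAt n ↝_) (sym form≡) (left↝ -b>0) ,
      record
        { ε≡+       = ε≡+′
        ; a>0       = subst (λ s → 0ℤ <ᶻ coeffA s) (sym form≡) (a>0 on)
        ; isLabelOf = subst (labelAt (left (path n)) IsLabelOf_) (sym form≡)
            (IsLabelOf-left (_∣_.equality (Triple.d∣N-c² (tripleAt (path n)))) -b>0 (isLabelOf on))
        }
    ... | inj₂ (b>0 , ε≡-) rewrite path-right n ε≡- =
      right↝ b>0 ,
      record { ε≡+ = ε≡+ on ; a>0 = b>0 ; isLabelOf = IsLabelOf-right (isLabelOf on) }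

    onPath : p *ᶻ p <ᶻ + N → ∀ n → OnPath (path n)
    onPath p²<N zero = record
      { ε≡+       = refl
      -- Subtracting p² from both sides of p² < N makes the dividend N - p² positive.
      ; a>0       = quotient>0 (ℤ.+<+ (ℕ.>-nonZero⁻¹ q)) q∣N-p²
                      (subst (_<ᶻ + N -ᶻ p *ᶻ p) (ℤ.+-inverseʳ (p *ᶻ p)) (ℤ.+-monoˡ-< (-ᶻ (p *ᶻ p)) p²<N))
      ; isLabelOf = α-isLabel
      }
    onPath p²<N (suc n) = proj₂ (path-step n (onPath p²<N n))

-- From periodic forms to periodic labels

proposition3 : (N : ℕ) → .{{_ : NonZero N}} → (N≢□ : ¬ PerfectSquare N) →
    (p : ℤ) → p *ᶻ p <ᶻ + N →
    (q : ℕ) → .{{_ : NonZero q}} → (q∣N-p² : + q ∣ + N -ᶻ p *ᶻ p) →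
    ∃ λ (T : ℕ) → 0 < T × (∀ (n : ℕ) → x N≢□ p q q∣N-p² (n +ⁿ T) ≡ x N≢□ p q q∣N-p² n)
proposition3 N N≢□ p p²<N q q∣N-p² = T , T>0 , λ n →
  IsLabelOf-unique
    (subst (x N≢□ p q q∣N-p² (n +ⁿ T) IsLabelOf_) (period n) (isLabelOf (on (n +ⁿ T))))
    (isLabelOf (on n))
  where
  open OnPath
  -- The period is sought among forms, as the vertices of a descending path never repeat; equal
  -- forms then have equal labels.
  s = formAt N≢□ p q q∣N-p²
  on = onPath N≢□ p q q∣N-p² p²<N

  step : ∀ n → s n ↝ s (suc n)
  step n = proj₁ (path-step N≢□ p q q∣N-p² n (on n))

  tripleOf : ℕ → Triple N
  tripleOf n = tripleAt N≢□ p q q∣N-p² (path N≢□ p q q∣N-p² n)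

  positive : ∀ n → Positive (s n)
  positive n = a>0 (on n) , Triple.d>0 (tripleOf n)

  bounded : ∀ n → BoundedBy N (s n)
  bounded n = Positive⇒bounded {s = s n} (positive n)
    (_∣_.equality (Triple.d∣N-c² (tripleOf n)))

  periodic = purelyPeriodic s
    (λ {i} {j} eq → ↝-deterministic (step i) (subst (_↝ s (suc j)) (sym eq) (step j)))
    (λ {i} {j} eq → ↝-injective (positive i) (positive j) (step i) (subst (s j ↝_) (sym eq) (step j)))
    (λ n → encode (s n) (bounded n))
    (λ {i} {j} → encode-injective {s = s i} {s j} (bounded i) (bounded j))

  T = proj₁ periodic
  T>0 = proj₁ (proj₂ periodic)
  period = proj₂ (proj₂ periodic)
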